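{- Let $X$ be a modal formula and $Y$ a propositional formula. Then $\Theta(X,\Box Y)=\min(\Pi(X\cup\Box Y),\models_{\Box Y})$.
   Context: Modal formulas over a countable set of variables with $\neg,\vee,\Diamond$ ($\Box\phi:=\neg\Diamond\neg\phi$), interpreted in Kripke models $\langle W,R,v\rangle$ with the standard truth definition; propositional formulas have no modal operators. The paper defines $\phi\models\psi$ as: for all models $\mathcal{M}$ and worlds $w$, $\mathcal{M},w\models\phi$ implies $\mathcal{M},w\models\psi$, and declares it works with global consequence. $\equiv$ is mutual consequence. Sets of formulas are read as conjunctions, so $X\cup\Box Y$ means $X\wedge\Box Y$. For formulas $X_1,X_2,Z$: $X_1\models_Z X_2$ iff $X_1\wedge Z\models X_2$, and $X_1\equiv_Z X_2$ iff both directions hold. Literals are $a$, $\neg a$ ($a$ a variable), $\Box F$, $\Diamond F$ with $F$ built from $a,\neg a$ by $\wedge,\vee,\Box,\Diamond$; a clause is a disjunction of literals. An implicate of $X$ is a clause $C$ with $X\models C$; a prime implicate is an implicate $C$ such that every implicate $C'$ with $C'\models C$ satisfies $C'\equiv C$; $\Pi(X)$ is the set of prime implicates. A theory implicate of $X$ w.r.t. $Z$ is a clause $C$ with $X\models_Z C$; it is a theory prime implicate if every theory implicate $C'$ with $C'\models_Z C$ satisfies $C'\equiv_Z C$; $\Theta(X,Z)$ is the set of theory prime implicates. For a set $S$ of clauses, $\min(S,\models_Z)$ is the set of $C'\in S$ such that for all $C\in S$, $C\models_Z C'$ implies $C\equiv_Z C'$.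
   Formalization: The equality is proved up to equivalence modulo □Y: Θ(X,□Y) is the set of clauses ≡_{□Y}-equivalent to a member of min(Π(X∪□Y),⊨_{□Y}); literal equality fails for X=a, Y=b, as the clause a∨◇¬b is in Θ(X,□Y) but is not a prime implicate of a∧□b. -}

module Defs where

open import Data.Nat using (ℕ)
open import Data.Product using (_×_; ∃-syntax)
open import Data.Sum using (_⊎_)
open import Level using (0ℓ; suc)
open import Relation.Nullary using (¬_)
open import Relation.Unary using (Pred; _∈_)

Var : Set
Var = ℕ

infix  9 ∼_ ◇_ □_
infixr 7 _∧_
infixr 6 _∨_

data Formula : Set where
  var : Var → Formula
  ∼_  : Formula → Formula
  _∨_ : Formula → Formula → Formula
  ◇_  : Formula → Formula

_∧_ : Formula → Formula → Formula
φ ∧ ψ = ∼ (∼ φ ∨ ∼ ψ)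

□_ : Formula → Formula
□ φ = ∼ (◇ (∼ φ))

data Propositional : Formula → Set where
  var : ∀ a → Propositional (var a)
  ∼_  : ∀ {φ} → Propositional φ → Propositional (∼ φ)
  _∨_ : ∀ {φ ψ} → Propositional φ → Propositional ψ → Propositional (φ ∨ ψ)

record Model : Set₁ where
  field
    World : Set
    R     : World → World → Set
    v     : World → Var → Set

open Model public

infix 3 _∙_⊩_

_∙_⊩_ : (M : Model) → World M → Formula → Set
M ∙ w ⊩ var a = v M w a
M ∙ w ⊩ ∼ φ   = ¬ (M ∙ w ⊩ φ)
M ∙ w ⊩ φ ∨ ψ = (M ∙ w ⊩ φ) ⊎ (M ∙ w ⊩ ψ)
M ∙ w ⊩ ◇ φ   = ∃[ u ] (R M w u × (M ∙ u ⊩ φ))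

infix 3 _⊨_ _≣_ _⊨[_]_ _≣[_]_

_⊨_ : Formula → Formula → Set₁
φ ⊨ ψ = ∀ M (w : World M) → M ∙ w ⊩ φ → M ∙ w ⊩ ψ

_≣_ : Formula → Formula → Set₁
φ ≣ ψ = (φ ⊨ ψ) × (ψ ⊨ φ)

_⊨[_]_ : Formula → Formula → Formula → Set₁
φ ⊨[ Z ] ψ = φ ∧ Z ⊨ ψ

_≣[_]_ : Formula → Formula → Formula → Set₁
φ ≣[ Z ] ψ = (φ ⊨[ Z ] ψ) × (ψ ⊨[ Z ] φ)

-- The formulas F allowed below a modality in a literal.
data NNF : Formula → Set where
  pos : ∀ a → NNF (var a)
  neg : ∀ a → NNF (∼ var a)
  and : ∀ {φ ψ} → NNF φ → NNF ψ → NNF (φ ∧ ψ)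
  or  : ∀ {φ ψ} → NNF φ → NNF ψ → NNF (φ ∨ ψ)
  box : ∀ {φ} → NNF φ → NNF (□ φ)
  dia : ∀ {φ} → NNF φ → NNF (◇ φ)

data Literal : Formula → Set where
  pos : ∀ a → Literal (var a)
  neg : ∀ a → Literal (∼ var a)
  box : ∀ {φ} → NNF φ → Literal (□ φ)
  dia : ∀ {φ} → NNF φ → Literal (◇ φ)

data Clause : Formula → Set where
  lit : ∀ {φ} → Literal φ → Clause φ
  or  : ∀ {φ ψ} → Clause φ → Clause ψ → Clause (φ ∨ ψ)

Implicate : Formula → Pred Formula (suc 0ℓ)
Implicate X C = Clause C × (X ⊨ C)

Π : Formula → Pred Formula (suc 0ℓ)
Π X C = C ∈ Implicate X
      × (∀ C′ → C′ ∈ Implicate X → C′ ⊨ C → C′ ≣ C)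

TheoryImplicate : Formula → Formula → Pred Formula (suc 0ℓ)
TheoryImplicate X Z C = Clause C × (X ⊨[ Z ] C)

Θ : Formula → Formula → Pred Formula (suc 0ℓ)
Θ X Z C = C ∈ TheoryImplicate X Z
        × (∀ C′ → C′ ∈ TheoryImplicate X Z → C′ ⊨[ Z ] C → C′ ≣[ Z ] C)

min : Pred Formula (suc 0ℓ) → Formula → Pred Formula (suc 0ℓ)
min S Z C′ = C′ ∈ S
           × (∀ C → C ∈ S → C ⊨[ Z ] C′ → C ≣[ Z ] C′)

-- The clauses that are Z-equivalent to a member of S.  Theory prime implicates
-- are only determined up to ≣[ Z ], and Θ X Z is closed under it among clauses,
-- whereas Π (X ∧ Z) is only closed under ≣: for X = a and Z = □ b, the clause
-- a ∨ ◇ ∼ b is Z-equivalent to a and lies in Θ X Z, but it is not in Π (X ∧ Z).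
-- A set of clauses compared with Θ X Z is therefore read up to ≣[ Z ].
_upTo≣[_] : Pred Formula (suc 0ℓ) → Formula → Pred Formula (suc 0ℓ)
(S upTo≣[ Z ]) D = Clause D × (∃[ C ] (C ∈ S × (D ≣[ Z ] C)))

{-# OPTIONS --safe #-}

-- Write Z for □ Y. Theory implicates of X with respect to Z are exactly the
-- implicates of X ∧ Z, so the theorem reduces to the covering property: every
-- implicate of a formula is entailed by one of its prime implicates.
--
-- Let T be a term of a disjunctive normal form of X, and let β be the
-- conjunction of all φ with □ φ in T. If T entails a clause C that is not valid,
-- then C is already entailed by a single consequence of T, namely a
-- propositional literal of T, □ β, ◇ (η ∧ β) for some ◇ η in T, or a
-- contradiction: otherwise the countermodels for these literals can be hung
-- under a new root satisfying T but not C. Hence there are finitely many clauses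
-- such that, whenever X entails a clause C, one of them lies between X and C.
-- This makes every implicate lie above a minimal one.
module Submission where

open import Defs
open import Axiom.ExcludedMiddle using (ExcludedMiddle)
open import Data.Empty using (⊥-elim)
open import Data.List using (List; []; _∷_; _++_; map; cartesianProductWith)
open import Data.List.Membership.Propositional using () renaming (_∈_ to _∈ˡ_)
open import Data.List.Membership.Propositional.Properties
  using (∈-map⁺; ∈-cartesianProductWith⁺)
open import Data.List.Relation.Unary.All as All using (All; []; _∷_)
import Data.List.Relation.Unary.All.Properties as All
open import Data.List.Relation.Unary.Any using (Any; here; there)
import Data.List.Relation.Unary.Any.Properties as Any
open import Data.Maybe using (Maybe; nothing; just)
open import Data.Product using (_×_; _,_; ∃; ∃-syntax; proj₁; proj₂)
open import Data.Sum as Sum using (_⊎_; inj₁; inj₂; [_,_])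
open import Function using (_∘_; id; _⇔_; mk⇔; Equivalence)
open import Level using (Lift; lift; lower; 0ℓ; suc)
open import Relation.Binary using (Rel; Reflexive; Transitive)
open import Relation.Binary.PropositionalEquality using (refl)
open import Relation.Nullary using (¬_; yes; no; contradiction)
open import Relation.Nullary.Decidable using (map′; decidable-stable)
open import Relation.Unary using (Pred; _∈_; _≐_)

open Equivalence using (to; from)

-- Terms and negation normal form.

Term : Set
Term = List (∃ Literal)

infix 3 _∙_⊩⋀_

_∙_⊩⋀_ : (M : Model) → World M → Term → Set
M ∙ w ⊩⋀ T = All (λ ℓ → M ∙ w ⊩ proj₁ ℓ) T

-- Putting the contradiction under `◇` makes `⊥ᶠ` a literal, hence a clause, which `var 0 ∧ ∼ var 0`
-- is not.
⊤ᶠ ⊥ᶠ : Formula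
⊤ᶠ = var 0 ∨ ∼ var 0
⊥ᶠ = ◇ (var 0 ∧ ∼ var 0)

⊤-nnf : NNF ⊤ᶠ
⊤-nnf = or (pos 0) (neg 0)

⊤-clause : Clause ⊤ᶠ
⊤-clause = or (lit (pos 0)) (lit (neg 0))

⊥-literal : Literal ⊥ᶠ
⊥-literal = dia (and (pos 0) (neg 0))

⊥-unsatisfiable : ∀ M (w : World M) → ¬ (M ∙ w ⊩ ⊥ᶠ)
⊥-unsatisfiable M w (u , _ , h) = h (inj₂ (λ ¬a → h (inj₁ ¬a)))

∧-intro : ∀ M (w : World M) φ ψ → M ∙ w ⊩ φ → M ∙ w ⊩ ψ → M ∙ w ⊩ φ ∧ ψ
∧-intro M w φ ψ p q = [ (λ ¬p → ¬p p) , (λ ¬q → ¬q q) ]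

□-intro : ∀ M (w : World M) φ → (∀ u → R M w u → M ∙ u ⊩ φ) → M ∙ w ⊩ □ φ
□-intro M w φ h (u , r , ¬p) = ¬p (h u r)

nnf nnf∼ : Formula → Formula
nnf (var a) = var a
nnf (∼ φ)   = nnf∼ φ
nnf (φ ∨ ψ) = nnf φ ∨ nnf ψ
nnf (◇ φ)   = ◇ nnf φ
nnf∼ (var a) = ∼ var a
nnf∼ (∼ φ)   = nnf φ
nnf∼ (φ ∨ ψ) = nnf∼ φ ∧ nnf∼ ψ
nnf∼ (◇ φ)   = □ nnf∼ φ

nnf-NNF  : ∀ φ → NNF (nnf φ)
nnf∼-NNF : ∀ φ → NNF (nnf∼ φ)
nnf-NNF (var a) = pos a
nnf-NNF (∼ φ)   = nnf∼-NNF φ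
nnf-NNF (φ ∨ ψ) = or (nnf-NNF φ) (nnf-NNF ψ)
nnf-NNF (◇ φ)   = dia (nnf-NNF φ)
nnf∼-NNF (var a) = neg a
nnf∼-NNF (∼ φ)   = nnf-NNF φ
nnf∼-NNF (φ ∨ ψ) = and (nnf∼-NNF φ) (nnf∼-NNF ψ)
nnf∼-NNF (◇ φ)   = box (nnf∼-NNF φ)

-- Disjunctive normal forms and the finite stock of clauses.

dnf : ∀ {φ} → NNF φ → List Term
dnf (pos a)   = ((_ , pos a) ∷ []) ∷ []
dnf (neg a)   = ((_ , neg a) ∷ []) ∷ []
dnf (and m n) = cartesianProductWith _++_ (dnf m) (dnf n)
dnf (or m n)  = dnf m ++ dnf n
dnf (box n)   = ((_ , box n) ∷ []) ∷ []
dnf (dia n)   = ((_ , dia n) ∷ []) ∷ []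

boxPart : Term → Formula
boxPart []                    = ⊤ᶠ
boxPart ((_ , pos a)     ∷ T) = boxPart T
boxPart ((_ , neg a)     ∷ T) = boxPart T
boxPart ((_ , box {φ} _) ∷ T) = φ ∧ boxPart T
boxPart ((_ , dia _)     ∷ T) = boxPart T

boxPart-NNF : ∀ T → NNF (boxPart T)
boxPart-NNF []                = ⊤-nnf
boxPart-NNF ((_ , pos a) ∷ T) = boxPart-NNF T
boxPart-NNF ((_ , neg a) ∷ T) = boxPart-NNF T
boxPart-NNF ((_ , box n) ∷ T) = and n (boxPart-NNF T)
boxPart-NNF ((_ , dia _) ∷ T) = boxPart-NNF T

strengthen : ∀ {β} → NNF β → ∃ Literal → ∃ Literal
strengthen b (_ , pos a) = _ , pos a
strengthen b (_ , neg a) = _ , neg a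
strengthen b (_ , box _) = _ , box b
strengthen b (_ , dia n) = _ , dia (and n b)

-- `□ β` heads the list even when `T` has no box literal: its countermodel is what refutes the box
-- literals of a clause at the glued root.
strongLiterals : Term → Term
strongLiterals T = (_ , box b) ∷ map (strengthen b) T
  where b = boxPart-NNF T

-- A clause here picks one literal per term; `⊥-literal` serves unsatisfiable terms, and the final
-- `⊥ᶠ` is the empty disjunction. The list does not depend on the clause to be interpolated, so the
-- search for minimal implicates is finite.
choices : List Term → List Formula
choices []       = ⊥ᶠ ∷ []
choices (T ∷ Ts) =
  cartesianProductWith _∨_ (map proj₁ ((_ , ⊥-literal) ∷ strongLiterals T)) (choices Ts)

literals : ∀ {C} → Clause C → Term
literals (lit l)  = (_ , l) ∷ []
literals (or c d) = literals c ++ literals d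

literals-sound : ∀ {C} (c : Clause C) M (w : World M) →
                 ∀ {ℓ} → ℓ ∈ˡ literals c → M ∙ w ⊩ proj₁ ℓ → M ∙ w ⊩ C
literals-sound (lit l)  M w (here refl) p = p
literals-sound (or c d) M w ℓ∈ p with Any.++⁻ (literals c) ℓ∈
... | inj₁ ℓ∈c = inj₁ (literals-sound c M w ℓ∈c p)
... | inj₂ ℓ∈d = inj₂ (literals-sound d M w ℓ∈d p)

literals-complete : ∀ {C} (c : Clause C) M (w : World M) → M ∙ w ⊩ C →
                    ∃[ ℓ ] (ℓ ∈ˡ literals c × (M ∙ w ⊩ proj₁ ℓ))
literals-complete (lit l)  M w p = _ , here refl , p
literals-complete (or c d) M w (inj₁ p) with literals-complete c M w p
... | ℓ , ℓ∈ , q = ℓ , Any.++⁺ˡ ℓ∈ , q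
literals-complete (or c d) M w (inj₂ p) with literals-complete d M w p
... | ℓ , ℓ∈ , q = ℓ , Any.++⁺ʳ (literals c) ℓ∈ , q

-- Gluing models under a new root.

module Glue {J : Set} (M : J → Model) (S : ∀ j → World (M j) → Set) (V : Var → Set) where

  data Edge : Rel (Maybe (∃[ j ] World (M j))) 0ℓ where
    root  : ∀ {j x} → S j x → Edge nothing (just (j , x))
    inner : ∀ {j x y} → R (M j) x y → Edge (just (j , x)) (just (j , y))

  glue : Model
  glue .World = Maybe (∃[ j ] World (M j))
  glue .R     = Edge
  glue .v nothing        = V
  glue .v (just (j , x)) = v (M j) x

  -- No edge leaves a component, so each `M j` is a generated submodel of `glue`.
  glue-⇔ : ∀ φ {j x} → (glue ∙ just (j , x) ⊩ φ) ⇔ (M j ∙ x ⊩ φ)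
  glue-⇔ (var a) = mk⇔ id id
  glue-⇔ (∼ φ)   = mk⇔ (_∘ from (glue-⇔ φ)) (_∘ to (glue-⇔ φ))
  glue-⇔ (φ ∨ ψ) = mk⇔ (Sum.map (to (glue-⇔ φ)) (to (glue-⇔ ψ)))
                        (Sum.map (from (glue-⇔ φ)) (from (glue-⇔ ψ)))
  glue-⇔ (◇ φ)   = mk⇔ (λ { (_ , inner r , p) → _ , r , to (glue-⇔ φ) p })
                        (λ { (_ , r , p) → _ , inner r , from (glue-⇔ φ) p })

-- Classical semantics of the normal forms.

module Classical (em : ExcludedMiddle (suc 0ℓ)) where

  -- Truth at a world lives in `Set`, entailment in `Set₁`; both levels are decided.
  em₀ : ExcludedMiddle 0ℓ
  em₀ {P} = map′ lower lift (em {Lift (suc 0ℓ) P})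

  ⊤-valid : ∀ M (w : World M) → M ∙ w ⊩ ⊤ᶠ
  ⊤-valid M w with em₀ {v M w 0}
  ... | yes p = inj₁ p
  ... | no ¬p = inj₂ ¬p

  ∧-elim : ∀ M (w : World M) φ ψ → M ∙ w ⊩ φ ∧ ψ → (M ∙ w ⊩ φ) × (M ∙ w ⊩ ψ)
  ∧-elim M w φ ψ h = decidable-stable em₀ (h ∘ inj₁) , decidable-stable em₀ (h ∘ inj₂)

  □-elim : ∀ M (w : World M) φ → M ∙ w ⊩ □ φ → ∀ u → R M w u → M ∙ u ⊩ φ
  □-elim M w φ h u r = decidable-stable em₀ (λ ¬p → h (u , r , ¬p))

  countermodel : ∀ φ ψ → ¬ (φ ⊨ ψ) → ∃[ M ] ∃[ w ] ((M ∙ w ⊩ φ) × ¬ (M ∙ w ⊩ ψ))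
  countermodel φ ψ ¬φ⊨ψ = decidable-stable em λ none →
    ¬φ⊨ψ λ M w p → decidable-stable em₀ λ ¬q → none (M , w , p , ¬q)

  nnf-⇒  : ∀ φ → φ ⊨ nnf φ
  nnf∼-⇒ : ∀ φ → ∼ φ ⊨ nnf∼ φ
  nnf-⇒ (var a) M w p = p
  nnf-⇒ (∼ φ)   M w p = nnf∼-⇒ φ M w p
  nnf-⇒ (φ ∨ ψ) M w p = Sum.map (nnf-⇒ φ M w) (nnf-⇒ ψ M w) p
  nnf-⇒ (◇ φ)   M w (u , r , p) = u , r , nnf-⇒ φ M u p
  nnf∼-⇒ (var a) M w p = p
  nnf∼-⇒ (∼ φ)   M w p = nnf-⇒ φ M w (decidable-stable em₀ p)
  nnf∼-⇒ (φ ∨ ψ) M w p = ∧-intro M w (nnf∼ φ) (nnf∼ ψ)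
    (nnf∼-⇒ φ M w (p ∘ inj₁)) (nnf∼-⇒ ψ M w (p ∘ inj₂))
  nnf∼-⇒ (◇ φ)   M w p = □-intro M w (nnf∼ φ) λ u r → nnf∼-⇒ φ M u λ q → p (u , r , q)

  nnf-⇐  : ∀ φ → nnf φ ⊨ φ
  nnf∼-⇐ : ∀ φ → nnf∼ φ ⊨ ∼ φ
  nnf-⇐ (var a) M w p = p
  nnf-⇐ (∼ φ)   M w p = nnf∼-⇐ φ M w p
  nnf-⇐ (φ ∨ ψ) M w p = Sum.map (nnf-⇐ φ M w) (nnf-⇐ ψ M w) p
  nnf-⇐ (◇ φ)   M w (u , r , p) = u , r , nnf-⇐ φ M u p
  nnf∼-⇐ (var a) M w p = p
  nnf∼-⇐ (∼ φ)   M w p ¬q = ¬q (nnf-⇐ φ M w p)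
  nnf∼-⇐ (φ ∨ ψ) M w p with ∧-elim M w (nnf∼ φ) (nnf∼ ψ) p
  ... | p₁ , p₂ = [ nnf∼-⇐ φ M w p₁ , nnf∼-⇐ ψ M w p₂ ]
  nnf∼-⇐ (◇ φ)   M w p (u , r , q) = nnf∼-⇐ φ M u (□-elim M w (nnf∼ φ) p u r) q

  dnf-⇒ : ∀ {φ} (n : NNF φ) M (w : World M) → M ∙ w ⊩ φ → Any (M ∙ w ⊩⋀_) (dnf n)
  dnf-⇒ (pos a) M w p = here (p ∷ [])
  dnf-⇒ (neg a) M w p = here (p ∷ [])
  dnf-⇒ (and {φ} {ψ} m n) M w p with ∧-elim M w φ ψ p
  ... | p₁ , p₂ = Any.cartesianProductWith⁺ _++_ All.++⁺ (dnf-⇒ m M w p₁) (dnf-⇒ n M w p₂)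
  dnf-⇒ (or m n) M w (inj₁ p) = Any.++⁺ˡ (dnf-⇒ m M w p)
  dnf-⇒ (or m n) M w (inj₂ p) = Any.++⁺ʳ (dnf m) (dnf-⇒ n M w p)
  dnf-⇒ (box n) M w p = here (p ∷ [])
  dnf-⇒ (dia n) M w p = here (p ∷ [])

  dnf-⇐ : ∀ {φ} (n : NNF φ) M (w : World M) → Any (M ∙ w ⊩⋀_) (dnf n) → M ∙ w ⊩ φ
  dnf-⇐ (pos a) M w (here (p ∷ [])) = p
  dnf-⇐ (neg a) M w (here (p ∷ [])) = p
  dnf-⇐ (and {φ} {ψ} m n) M w p
    with Any.cartesianProductWith⁻ _++_ (λ {T} → All.++⁻ T) (dnf m) (dnf n) p
  ... | p₁ , p₂ = ∧-intro M w φ ψ (dnf-⇐ m M w p₁) (dnf-⇐ n M w p₂)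
  dnf-⇐ (or m n) M w p =
    Sum.map (dnf-⇐ m M w) (dnf-⇐ n M w) (Any.++⁻ (dnf m) p)
  dnf-⇐ (box n) M w (here (p ∷ [])) = p
  dnf-⇐ (dia n) M w (here (p ∷ [])) = p

  boxPart-⇒ : ∀ T M (w : World M) → M ∙ w ⊩⋀ T → ∀ u → R M w u → M ∙ u ⊩ boxPart T
  boxPart-⇒ [] M w [] u r = ⊤-valid M u
  boxPart-⇒ ((_ , pos a) ∷ T) M w (_ ∷ ps) u r = boxPart-⇒ T M w ps u r
  boxPart-⇒ ((_ , neg a) ∷ T) M w (_ ∷ ps) u r = boxPart-⇒ T M w ps u r
  boxPart-⇒ ((_ , box {φ} _) ∷ T) M w (p ∷ ps) u r =
    ∧-intro M u φ (boxPart T) (□-elim M w φ p u r) (boxPart-⇒ T M w ps u r)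
  boxPart-⇒ ((_ , dia _) ∷ T) M w (_ ∷ ps) u r = boxPart-⇒ T M w ps u r

  boxPart-⇐ : ∀ T M (u : World M) → M ∙ u ⊩ boxPart T →
              ∀ {φ} {n : NNF φ} → (□ φ , box n) ∈ˡ T → M ∙ u ⊩ φ
  boxPart-⇐ ((_ , pos a) ∷ T) M u p (there φ∈) = boxPart-⇐ T M u p φ∈
  boxPart-⇐ ((_ , neg a) ∷ T) M u p (there φ∈) = boxPart-⇐ T M u p φ∈
  boxPart-⇐ ((_ , box {φ} _) ∷ T) M u p (here refl) =
    proj₁ (∧-elim M u φ (boxPart T) p)
  boxPart-⇐ ((_ , box {φ} _) ∷ T) M u p (there φ∈) =
    boxPart-⇐ T M u (proj₂ (∧-elim M u φ (boxPart T) p)) φ∈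
  boxPart-⇐ ((_ , dia _) ∷ T) M u p (there φ∈) = boxPart-⇐ T M u p φ∈

  strongLiterals-sound : ∀ T M (w : World M) → M ∙ w ⊩⋀ T → M ∙ w ⊩⋀ strongLiterals T
  strongLiterals-sound T M w ps =
    □β ∷ All.map⁺ (All.map (λ {ℓ} → strengthened ℓ) ps)
    where
    □β : M ∙ w ⊩ □ boxPart T
    □β = □-intro M w (boxPart T) (boxPart-⇒ T M w ps)
    strengthened : ∀ ℓ → M ∙ w ⊩ proj₁ ℓ →
                   M ∙ w ⊩ proj₁ (strengthen (boxPart-NNF T) ℓ)
    strengthened (_ , pos a) p = p
    strengthened (_ , neg a) p = p
    strengthened (_ , box _) p = □β
    strengthened (_ , dia {φ} _) (u , r , p) =
      u , r , ∧-intro M u φ (boxPart T) p (boxPart-⇒ T M w ps u r)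

  -- The glued countermodel for a term and a clause.

  module _ (T : Term) {C : Formula} (c : Clause C)
           (T-sat : ∃[ M ] ∃[ w ] (M ∙ w ⊩⋀ T))
           (C-refutable : ∃[ M ] ∃[ w ] ¬ (M ∙ w ⊩ C))
           (¬strong⊨C : ∀ {ℓ} → ℓ ∈ˡ strongLiterals T → ¬ (proj₁ ℓ ⊨ C))
           where

    private
      β = boxPart T

      J : Set
      J = ∃[ ℓ ] (ℓ ∈ˡ strongLiterals T)

      counter : (j : J) → ∃[ M ] ∃[ w ] ((M ∙ w ⊩ proj₁ (proj₁ j)) × ¬ (M ∙ w ⊩ C))
      counter (ℓ , ℓ∈) = countermodel (proj₁ ℓ) C (¬strong⊨C ℓ∈)

      M : J → Model
      M j = proj₁ (counter j)

      w₀ : ∀ j → World (M j)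
      w₀ j = proj₁ (proj₂ (counter j))

      ¬C : ∀ j → ¬ (M j ∙ w₀ j ⊩ C)
      ¬C j = proj₂ (proj₂ (proj₂ (counter j)))

      ⊩ℓ : ∀ j → M j ∙ w₀ j ⊩ proj₁ (proj₁ j)
      ⊩ℓ j = proj₁ (proj₂ (proj₂ (counter j)))

      -- The root sees successors of `w₀ j`, not `w₀ j` itself. Being such successors keeps the
      -- diamonds of `C` false at the root; satisfying `β` keeps the boxes of `T` true there.
      S : ∀ j → World (M j) → Set
      S j x = R (M j) (w₀ j) x × (M j ∙ x ⊩ β)

      -- The least valuation making the positive literals of `T` true and the negative literals of
      -- `C` false.
      V : Var → Set
      V a = ((_ , pos a) ∈ˡ T) ⊎ ((_ , neg a) ∈ˡ literals c)

      open Glue M S V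

      strengthened∈ : ∀ {ℓ} → ℓ ∈ˡ T →
                      strengthen (boxPart-NNF T) ℓ ∈ˡ strongLiterals T
      strengthened∈ ℓ∈ = there (∈-map⁺ _ ℓ∈)

      ⊩T : ∀ ℓ → ℓ ∈ˡ T → glue ∙ nothing ⊩ proj₁ ℓ
      ⊩T (_ , pos a) ℓ∈ = inj₁ ℓ∈
      -- Both `a` and `∼ a` would occur in `T`, which is satisfiable.
      ⊩T (_ , neg a) ℓ∈ (inj₁ a∈) =
        let _ , _ , ps = T-sat in All.lookup ps ℓ∈ (All.lookup ps a∈)
      -- `∼ a` would be shared by `T` and `C`, so a strong literal would entail `C`.
      ⊩T (_ , neg a) ℓ∈ (inj₂ a∈) =
        ¬strong⊨C (strengthened∈ ℓ∈) λ M w → literals-sound c M w a∈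
      ⊩T (_ , box {φ} _) ℓ∈ = □-intro glue nothing φ λ where
        _ (root {j} {x} (_ , p)) → from (glue-⇔ φ {j}) (boxPart-⇐ T (M j) x p ℓ∈)
      -- The countermodel for `◇ (φ ∧ β)` supplies the witness; the conjunct `β` is what lets the
      -- root see it.
      ⊩T (_ , dia {φ} _) ℓ∈ =
        let j = _ , strengthened∈ ℓ∈
            x , r , p = ⊩ℓ j
            q₁ , q₂ = ∧-elim (M j) x φ β p
        in _ , root {j} (r , q₂) , from (glue-⇔ φ {j}) q₁

      ⊮C : ∀ ℓ → ℓ ∈ˡ literals c → ¬ (glue ∙ nothing ⊩ proj₁ ℓ)
      ⊮C (_ , pos a) ℓ∈ (inj₁ a∈) =
        ¬strong⊨C (strengthened∈ a∈) λ M w → literals-sound c M w ℓ∈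
      -- With both `a` and `∼ a` among its literals, `C` could not be refuted anywhere.
      ⊮C (_ , pos a) ℓ∈ (inj₂ a∈) =
        let M , w , ¬p = C-refutable
        in ¬p (literals-sound c M w a∈ (¬p ∘ literals-sound c M w ℓ∈))
      ⊮C (_ , neg a) ℓ∈ ¬a = ¬a (inj₂ ℓ∈)
      -- In the countermodel for `□ β` every successor of `w₀ j` satisfies `β`, so the root sees
      -- them all, and `□ φ` at the root would carry over to `w₀ j`.
      ⊮C (_ , box {φ} _) ℓ∈ p =
        ¬C j (literals-sound c (M j) (w₀ j) ℓ∈ (□-intro (M j) (w₀ j) φ λ x r →
          to (glue-⇔ φ {j}) (□-elim glue nothing φ p _
            (root {j} (r , □-elim (M j) (w₀ j) β (⊩ℓ j) x r)))))
        where
        j : J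
        j = _ , here refl
      ⊮C (_ , dia {φ} _) ℓ∈ (_ , root {j} {x} (r , _) , p) =
        ¬C j (literals-sound c (M j) (w₀ j) ℓ∈ (x , r , to (glue-⇔ φ {j}) p))

    glued-countermodel : ∃[ M ] ∃[ w ] ((M ∙ w ⊩⋀ T) × ¬ (M ∙ w ⊩ C))
    glued-countermodel = glue , nothing , All.tabulate (λ {ℓ} → ⊩T ℓ) , λ p →
      let ℓ , ℓ∈ , q = literals-complete c glue nothing p in ⊮C ℓ ℓ∈ q

  -- Interpolating literals and clauses.

  interpolating-literal : ∀ T {C} → Clause C → ∃[ M ] ∃[ w ] ¬ (M ∙ w ⊩ C) →
    (∀ M w → M ∙ w ⊩⋀ T → M ∙ w ⊩ C) →
    ∃[ ℓ ] (ℓ ∈ˡ ((_ , ⊥-literal) ∷ strongLiterals T)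
          × (∀ M w → M ∙ w ⊩⋀ T → M ∙ w ⊩ proj₁ ℓ)
          × (proj₁ ℓ ⊨ C))
  interpolating-literal T c C-refutable T⊨C with em {∃[ M ] ∃[ w ] (M ∙ w ⊩⋀ T)}
  ... | no unsat = _ , here refl , (λ M w p → ⊥-elim (unsat (M , w , p)))
                 , λ M w p → ⊥-elim (⊥-unsatisfiable M w p)
  ... | yes sat = decidable-stable em λ none →
    let M , w , p , ¬q = glued-countermodel T c sat C-refutable λ ℓ∈ ℓ⊨C →
          none (_ , there ℓ∈ , (λ M w p → All.lookup (strongLiterals-sound T M w p) ℓ∈) , ℓ⊨C)
    in ¬q (T⊨C M w p)

  interpolating-choice : ∀ Ts {C} → Clause C → ∃[ M ] ∃[ w ] ¬ (M ∙ w ⊩ C) →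
    (∀ M w → Any (M ∙ w ⊩⋀_) Ts → M ∙ w ⊩ C) →
    ∃[ D ] (D ∈ˡ choices Ts × Clause D
          × (∀ M w → Any (M ∙ w ⊩⋀_) Ts → M ∙ w ⊩ D)
          × (D ⊨ C))
  interpolating-choice [] c C-refutable Ts⊨C =
    ⊥ᶠ , here refl , lit ⊥-literal , (λ _ _ ()) , λ M w p → ⊥-elim (⊥-unsatisfiable M w p)
  interpolating-choice (T ∷ Ts) c C-refutable Ts⊨C
    with interpolating-literal T c C-refutable (λ M w → Ts⊨C M w ∘ here)
       | interpolating-choice Ts c C-refutable (λ M w → Ts⊨C M w ∘ there)
  ... | (ℓ , l) , ℓ∈ , T⊨ℓ , ℓ⊨C | D , D∈ , d , Ts⊨D , D⊨C =
    ℓ ∨ D , ∈-cartesianProductWith⁺ _∨_ (∈-map⁺ proj₁ ℓ∈) D∈ , or (lit l) d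
    , (λ { M w (here p) → inj₁ (T⊨ℓ M w p) ; M w (there p) → inj₂ (Ts⊨D M w p) })
    , λ M w → [ ℓ⊨C M w , D⊨C M w ]

  interpolants : Formula → List Formula
  interpolants X = ⊤ᶠ ∷ choices (dnf (nnf-NNF X))

  interpolation : ∀ X {C} → C ∈ Implicate X →
                  ∃[ D ] (D ∈ˡ interpolants X × D ∈ Implicate X × (D ⊨ C))
  interpolation X {C} (c , X⊨C) with em {∃[ M ] ∃[ w ] ¬ (M ∙ w ⊩ C)}
  ... | no valid = ⊤ᶠ , here refl , (⊤-clause , λ M w _ → ⊤-valid M w)
                 , λ M w _ → decidable-stable em₀ λ ¬p → valid (M , w , ¬p)
  ... | yes refutable
    with interpolating-choice (dnf (nnf-NNF X)) c refutable
           (λ M w p → X⊨C M w (nnf-⇐ X M w (dnf-⇐ (nnf-NNF X) M w p)))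
  ...   | D , D∈ , d , X⊨D , D⊨C =
    D , there D∈ , (d , λ M w p → X⊨D M w (dnf-⇒ (nnf-NNF X) M w (nnf-⇒ X M w p))) , D⊨C

  -- Covering by prime implicates.

  minimal-below : {A : Set} {_≤_ : Rel A (suc 0ℓ)} → Reflexive _≤_ → Transitive _≤_ →
    (P : Pred A (suc 0ℓ)) (ys : List A) {x : A} → P x →
    ∃[ m ] (P m × (m ≤ x) × (∀ {y} → y ∈ˡ ys → P y → y ≤ m → m ≤ y))
  minimal-below rfl tr P [] px = _ , px , rfl , λ ()
  minimal-below {_≤_ = _≤_} rfl tr P (y ∷ ys) px
    with minimal-below {_≤_ = _≤_} rfl tr P ys px
  ... | m , pm , m≤x , min-m with em {P y × (y ≤ m)}
  ...   | yes (py , y≤m) = y , py , tr y≤m m≤x , λ where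
    (here refl) _ _    → rfl
    -- Replacing `m` by the smaller `y` preserves minimality: a `z` below `y` is below `m`, hence
    -- above `m` and so above `y`.
    (there z∈) pz z≤y → tr y≤m (min-m z∈ pz (tr z≤y y≤m))
  ...   | no ¬y = m , pm , m≤x , λ where
    (here refl) py y≤m → contradiction (py , y≤m) ¬y
    (there z∈)         → min-m z∈

  -- Minimality against the interpolants alone suffices: an implicate `D′` below `D` has an
  -- interpolant `E` below it, and minimality gives `D ⊨ E ⊨ D′`.
  prime-covering : ∀ X {C} → C ∈ Implicate X → ∃[ D ] (D ∈ Π X × (D ⊨ C))
  prime-covering X C∈
    with minimal-below {_≤_ = _⊨_} (λ _ _ → id) (λ φ⊨ψ ψ⊨χ M w → ψ⊨χ M w ∘ φ⊨ψ M w)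
           (Implicate X) (interpolants X) C∈
  ... | D , D∈ , D⊨C , min-D = D , (D∈ , prime) , D⊨C
    where
    prime : ∀ D′ → D′ ∈ Implicate X → D′ ⊨ D → D′ ≣ D
    prime D′ D′∈ D′⊨D with interpolation X D′∈
    ... | E , E∈ , E-imp , E⊨D′ =
      D′⊨D , λ M w → E⊨D′ M w ∘ min-D E∈ E-imp (λ M w → D′⊨D M w ∘ E⊨D′ M w) M w

  -- Theory prime implicates.

  ⊨⇒⊨[] : ∀ Z φ ψ → φ ⊨ ψ → φ ⊨[ Z ] ψ
  ⊨⇒⊨[] Z φ ψ φ⊨ψ M w = φ⊨ψ M w ∘ proj₁ ∘ ∧-elim M w φ Z

  ⊨[]-trans : ∀ Z φ ψ χ → φ ⊨[ Z ] ψ → ψ ⊨[ Z ] χ → φ ⊨[ Z ] χ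
  ⊨[]-trans Z φ ψ χ φ⊨ψ ψ⊨χ M w p =
    ψ⊨χ M w (∧-intro M w ψ Z (φ⊨ψ M w p) (proj₂ (∧-elim M w φ Z p)))

  -- A prime implicate `C` covering `D` is `Z`-equivalent to `D` by primality of `D`, and thereby
  -- inherits its minimality.
  Θ⊆min-Π : ∀ X Z {D} → D ∈ Θ X Z → D ∈ (min (Π (X ∧ Z)) Z) upTo≣[ Z ]
  Θ⊆min-Π X Z {D} (D∈@(d , _) , D-prime) with prime-covering (X ∧ Z) D∈
  ... | C , C∈@(C-imp , _) , C⊨D with D-prime C C-imp (⊨⇒⊨[] Z C D C⊨D)
  ...   | C⊨ᶻD , D⊨ᶻC = d , C , (C∈ , minimal) , D⊨ᶻC , C⊨ᶻD
    where
    minimal : ∀ E → E ∈ Π (X ∧ Z) → E ⊨[ Z ] C → E ≣[ Z ] C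
    minimal E (E-imp , _) E⊨C =
      E⊨C , ⊨[]-trans Z C D E C⊨ᶻD
              (proj₂ (D-prime E E-imp (⊨[]-trans Z E C D E⊨C C⊨ᶻD)))

  -- `C` competes only with prime implicates, so a rival `E` is replaced by a prime implicate `P`
  -- below it; minimality of `C` then places `C` below `P`, hence below `E`.
  min-Π⊆Θ : ∀ X Z {D} → D ∈ (min (Π (X ∧ Z)) Z) upTo≣[ Z ] → D ∈ Θ X Z
  min-Π⊆Θ X Z {D} (d , C , (((_ , X⊨C) , _) , C-min) , D⊨C , C⊨D) =
    (d , ⊨[]-trans Z X C D X⊨C C⊨D) , prime
    where
    prime : ∀ E → E ∈ TheoryImplicate X Z → E ⊨[ Z ] D → E ≣[ Z ] D
    prime E E-imp E⊨D with prime-covering (X ∧ Z) E-imp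
    ... | P , P∈ , P⊨E =
      E⊨D , ⊨[]-trans Z D C E D⊨C (⊨[]-trans Z C P E C⊨P P⊨ᶻE)
      where
      P⊨ᶻE : P ⊨[ Z ] E
      P⊨ᶻE = ⊨⇒⊨[] Z P E P⊨E
      C⊨P : C ⊨[ Z ] P
      C⊨P = proj₂ (C-min P P∈ (⊨[]-trans Z P E C P⊨ᶻE (⊨[]-trans Z E D C E⊨D D⊨C)))

theorem2 : ExcludedMiddle (suc 0ℓ) →
    ∀ (X Y : Formula) → Propositional Y →
    Θ X (□ Y) ≐ (min (Π (X ∧ □ Y)) (□ Y)) upTo≣[ □ Y ]
theorem2 em X Y _ = Θ⊆min-Π X (□ Y) , min-Π⊆Θ X (□ Y)
  where open Classical em
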